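{- Let $s\ge 1$ be an integer and let $G$ be a bikernel-perfect oriented graph having girth $g\ge 5$. If $\chi(G)\ge 2s^{1+\frac{4}{g-4}}$, then $G$ contains every oriented tree on $s$ vertices as an induced subgraph.
   Context: All graphs are finite. An oriented graph is an orientation of a simple graph; its girth and chromatic number are those of the underlying undirected graph. A kernel of a directed graph $D$ is an independent set $S$ such that every vertex $u\notin S$ has an out-neighbour in $S$ (i.e. some $v\in S$ with $(u,v)$ an arc). An antikernel is an independent set $S$ such that every $u\notin S$ has an in-neighbour in $S$ (some $v\in S$ with $(v,u)$ an arc). $D$ is bikernel-perfect if every induced subdigraph of $D$ has both a kernel and an antikernel. An oriented tree is an orientation of a tree; containing it as an induced subgraph means some vertex subset induces a subdigraph isomorphic to it as a directed graph. -}

module Defs where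

open import Data.Nat using (ℕ; zero; suc; _≤_; _<_)
open import Data.Fin using (Fin; zero; suc; inject₁; fromℕ)
open import Data.Fin.Subset using (Subset; _∈_; _∉_; _⊆_)
open import Data.Bool using (Bool; true)
open import Data.Product using (Σ; ∃; _×_)
open import Data.Sum using (_⊎_)
open import Data.Empty using (⊥)
open import Relation.Nullary using (¬_)
open import Relation.Binary.PropositionalEquality using (_≡_; _≢_)
open import Function.Definitions using (Injective)

record Digraph (n : ℕ) : Set where
  field
    arc : Fin n → Fin n → Bool

open Digraph public

Arc : ∀ {n} → Digraph n → Fin n → Fin n → Set
Arc D u v = arc D u v ≡ true

IsOriented : ∀ {n} → Digraph n → Set
IsOriented {n} D = (∀ (u : Fin n) → ¬ Arc D u u) × (∀ (u v : Fin n) → Arc D u v → ¬ Arc D v u)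

Adj : ∀ {n} → Digraph n → Fin n → Fin n → Set
Adj D u v = Arc D u v ⊎ Arc D v u

Independent : ∀ {n} → Digraph n → Subset n → Set
Independent {n} D S = ∀ (u v : Fin n) → u ∈ S → v ∈ S → ¬ Adj D u v

IsKernelOf : ∀ {n} → Digraph n → Subset n → Subset n → Set
IsKernelOf {n} D X K =
  K ⊆ X × Independent D K ×
  (∀ (u : Fin n) → u ∈ X → u ∉ K → ∃ λ v → v ∈ K × Arc D u v)

IsAntikernelOf : ∀ {n} → Digraph n → Subset n → Subset n → Set
IsAntikernelOf {n} D X K =
  K ⊆ X × Independent D K ×
  (∀ (u : Fin n) → u ∈ X → u ∉ K → ∃ λ v → v ∈ K × Arc D v u)

BikernelPerfect : ∀ {n} → Digraph n → Set
BikernelPerfect {n} D =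
  ∀ (X : Subset n) → (∃ λ K → IsKernelOf D X K) × (∃ λ K → IsAntikernelOf D X K)

HasCycleOfLength : ∀ {n} → Digraph n → ℕ → Set
HasCycleOfLength D zero = ⊥
HasCycleOfLength {n} D (suc m) =
  2 ≤ m × Σ (Fin (suc m) → Fin n) λ c →
    Injective _≡_ _≡_ c ×
    (∀ (i : Fin m) → Adj D (c (inject₁ i)) (c (suc i))) ×
    Adj D (c (fromℕ m)) (c zero)

IsGirth : ∀ {n} → Digraph n → ℕ → Set
IsGirth D g = HasCycleOfLength D g × (∀ k → k < g → ¬ HasCycleOfLength D k)

Colorable : ∀ {n} → Digraph n → ℕ → Set
Colorable {n} D k = Σ (Fin n → Fin k) λ f → ∀ (u v : Fin n) → Adj D u v → f u ≢ f v

IsChromaticNumber : ∀ {n} → Digraph n → ℕ → Set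
IsChromaticNumber D c = Colorable D c × (∀ k → Colorable D k → c ≤ k)

Connected : ∀ {n} → Digraph n → Set
Connected {n} D = ∀ (u v : Fin n) → Σ ℕ λ l → Σ (Fin (suc l) → Fin n) λ w →
  w zero ≡ u × w (fromℕ l) ≡ v × (∀ (i : Fin l) → Adj D (w (inject₁ i)) (w (suc i)))

IsOrientedTree : ∀ {n} → Digraph n → Set
IsOrientedTree D = IsOriented D × Connected D × (∀ k → ¬ HasCycleOfLength D k)

ContainsInduced : ∀ {n s} → Digraph n → Digraph s → Set
ContainsInduced {n} {s} G T = Σ (Fin s → Fin n) λ f →
  Injective _≡_ _≡_ f × (∀ (u v : Fin s) → arc T u v ≡ arc G (f u) (f v))

module Submission where

-- Each new leaf of a growing copy of T is assigned a block of D = ⌊χ/s⌋ kernels (or antikernels, according to the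
-- direction of its arc), peeled off from G one after the other, the last leaf first. A choice of one kernel for each
-- leaf then determines a homomorphism of T into G, and distinct vertices of T land in disjoint blocks. Put
-- k = ⌈(g−4)/2⌉. If non-adjacent v, w of T have adjacent images, then v or w has k ancestors (itself included) that
-- are not ancestors of the other, since otherwise G would have a closed walk without backtracking of length < g; and
-- the choices at these k places are determined by all other choices, since two of them would give such a closed walk
-- of length at most 2k + 2 < g. So a given pair spoils at most a fraction D⁻ᵏ of the choices, and s² < Dᵏ.

open import Defs
open import Data.Bool using (Bool; true; false; _∧_; not)
open import Data.Bool.Properties using (¬-not) renaming (_≟_ to _≟ᵇ_)
open import Data.Fin using (Fin; zero; suc; toℕ; fromℕ; fromℕ<; inject₁; combine; remQuot)
open import Data.Fin.Properties
  using ( _≟_; ¬∀⟶∃¬; any?; all?; toℕ<n; toℕ≤pred[n]; toℕ-fromℕ; toℕ-inject₁; toℕ-injective; injective⇒≤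
        ; suc-injective; fromℕ<-injective; remQuot-combine)
open import Data.Fin.Subset using (Subset; inside; outside; _∈_; _∉_; _⊆_; _∩_; ∁; ⊤; ⊥; ∣_∣)
open import Data.Fin.Subset.Properties
  using (_∈?_; nonempty?; ∈⊤; x∈p∩q⁺; x∈p∩q⁻; x∉p⇒x∈∁p; x∈∁p⇒x∉p; ∣⊥∣≡0)
open import Data.Nat
  using ( ℕ; zero; suc; _+_; _*_; _^_; _∸_; _≤_; _<_; z≤n; s≤s; s≤s⁻¹; z<s; ⌈_/2⌉; _/_; _%_; _≤?_; _<?_
        ; NonZero; >-nonZero; >-nonZero⁻¹)
open import Data.Nat.DivMod using (m≥n⇒m/n>0; m≡m%n+[m/n]*n; m%n<n; m/n*n≤m)
open import Data.Nat.Properties hiding (_≟_; _≤?_; _<?_; suc-injective)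
open import Data.Product using (Σ; ∃; _×_; _,_; proj₁; proj₂; map₂)
open import Data.Sum using (_⊎_; inj₁; inj₂; swap; [_,_]′)
open import Data.Vec using (Vec; []; _∷_)
open import Data.Vec.Properties using (∷-injectiveˡ; ∷-injectiveʳ)
import Data.Vec.Functional as Vector
open import Function using (_∘_)
open import Function.Definitions using (Injective)
open import Relation.Binary.PropositionalEquality
open import Relation.Nullary using (¬_; Dec; yes; no; does; contradiction; ¬?; _×-dec_; _⊎-dec_)

open import Algebra.Properties.CommutativeSemigroup *-commutativeSemigroup using (x∙yz≈y∙xz; interchange)
open import Algebra.Properties.Semiring.Sum +-*-semiring using (sum; ∑-comm; *-distribʳ-sum; sum-cong-≗)

-- Walks without backtracking and girth

NoShortCycle : ∀ {n} → Digraph n → ℕ → Set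
NoShortCycle H b = ∀ k → k < b → ¬ HasCycleOfLength H k

-- Walk H a b p q l: a walk without backtracking from a to q of length l, with second vertex b and penultimate vertex p.
data Walk {n} (H : Digraph n) : Fin n → Fin n → Fin n → Fin n → ℕ → Set where
  edge : ∀ {a b} → Adj H a b → Walk H a b a b 1
  cons : ∀ {a b c p q l} → Adj H a b → a ≢ c → Walk H b c p q l → Walk H a b p q (suc l)

snoc : ∀ {n} {H : Digraph n} {a b p q r l} → Walk H a b p q l → Adj H q r → p ≢ r → Walk H a b q r (suc l)
snoc (edge ab) qr p≢r = cons ab p≢r (edge qr)
snoc (cons ab a≢c W) qr p≢r = cons ab a≢c (snoc W qr p≢r)

Loopless : ∀ {n} → Digraph n → Set
Loopless H = ∀ u → ¬ Adj H u u

oriented⇒loopless : ∀ {n} {H : Digraph n} → IsOriented H → Loopless H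
oriented⇒loopless (irr , _) u (inj₁ a) = irr u a
oriented⇒loopless (irr , _) u (inj₂ a) = irr u a

-- Vertices are indexed by all of `ℕ`, and values beyond `l` are ignored; prefixes and extensions
-- then need no index conversion.
IsPath : ∀ {n} → Digraph n → (ℕ → Fin n) → ℕ → Set
IsPath H w l = (∀ {i j} → i ≤ l → j ≤ l → w i ≡ w j → i ≡ j) × (∀ {i} → i < l → Adj H (w i) (w (suc i)))

closed-path⇒cycle : ∀ {n} (H : Digraph n) {w l} → IsPath H w l → 2 ≤ l → Adj H (w l) (w 0) → HasCycleOfLength H (suc l)
closed-path⇒cycle H {w} {l} (inj , adj) 2≤l close = 2≤l , w ∘ toℕ ,
  (λ {i} {j} e → toℕ-injective (inj (toℕ≤pred[n] i) (toℕ≤pred[n] j) e)) ,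
  (λ i → subst (λ m → Adj H (w m) (w (suc (toℕ i)))) (sym (toℕ-inject₁ i)) (adj (toℕ<n i))) ,
  subst (λ m → Adj H (w m) (w 0)) (sym (toℕ-fromℕ l)) close

prefix : ∀ {n} (H : Digraph n) {w l m} → m ≤ l → IsPath H w l → IsPath H w m
prefix H m≤l (inj , adj) = (λ i≤m j≤m → inj (≤-trans i≤m m≤l) (≤-trans j≤m m≤l)) , (λ i<m → adj (≤-trans i<m m≤l))

infixr 5 _◂_
_◂_ : ∀ {A : Set} → A → (ℕ → A) → ℕ → A
(y ◂ w) zero = y
(y ◂ w) (suc i) = w i

extend : ∀ {n} (H : Digraph n) {w l y} → IsPath H w l → Adj H y (w 0) → (∀ i → i ≤ l → w i ≢ y) → IsPath H (y ◂ w) (suc l)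
extend H {w} {l} {y} (inj , adj) yw fresh = inj′ , adj′
  where
  inj′ : ∀ {i j} → i ≤ suc l → j ≤ suc l → (y ◂ w) i ≡ (y ◂ w) j → i ≡ j
  inj′ {zero} {zero} _ _ _ = refl
  inj′ {zero} {suc j} _ (s≤s j≤l) e = contradiction (sym e) (fresh j j≤l)
  inj′ {suc i} {zero} (s≤s i≤l) _ e = contradiction e (fresh i i≤l)
  inj′ {suc i} {suc j} (s≤s i≤l) (s≤s j≤l) e = cong suc (inj i≤l j≤l e)
  adj′ : ∀ {i} → i < suc l → Adj H ((y ◂ w) i) ((y ◂ w) (suc i))
  adj′ {zero} _ = yw
  adj′ {suc i} (s≤s i<l) = adj i<l

1≤length : ∀ {n} {H : Digraph n} {a b p q l} → Walk H a b p q l → 1 ≤ l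
1≤length (edge _) = s≤s z≤n
1≤length (cons _ _ _) = s≤s z≤n

-- A vertex put in front of a path is new or closes a cycle with an initial piece of it, no longer
-- than the walk. Meeting `w 0` would be a loop, meeting `w 1` a backtrack.
walk⇒path : ∀ {n} {H : Digraph n} {a b p q l g} → Loopless H → NoShortCycle H g → l < g → Walk H a b p q l →
  ∃ λ w → w 0 ≡ a × w 1 ≡ b × w l ≡ q × IsPath H w l
walk⇒path {H = H} {a} {b} loopless short _ (edge ab) =
  a ◂ (λ _ → b) , refl , refl , refl ,
  extend H ((λ { z≤n z≤n _ → refl }) , λ ()) ab (λ _ _ b≡a → loopless b (subst (λ z → Adj H z b) (sym b≡a) ab))
walk⇒path {H = H} {a} {l = suc l} {g} loopless short l<g (cons {c = c} ab a≢c W)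
  with walk⇒path loopless short (<⇒≤ l<g) W
... | w , refl , refl , refl , path = a ◂ w , refl , refl , refl , extend H path ab fresh
  where
  fresh : ∀ i → i ≤ l → w i ≢ a
  fresh zero _ w₀≡a = loopless (w 0) (subst (λ z → Adj H z (w 0)) (sym w₀≡a) ab)
  fresh (suc zero) _ w₁≡a = a≢c (sym w₁≡a)
  fresh i@(suc (suc _)) i≤l wᵢ≡a = short (suc i) (≤-<-trans (s≤s i≤l) l<g)
    (closed-path⇒cycle H (prefix H i≤l path) (s≤s (s≤s z≤n)) (subst (λ z → Adj H z (w 0)) (sym wᵢ≡a) ab))

-- The walk would be a path with equal ends. Nothing is asked of `b` and `p`, so no check for
-- backtracking is due at `a`.
¬closed-walk : ∀ {n} {H : Digraph n} {a b p l g} → Loopless H → NoShortCycle H g → l < g → ¬ Walk H a b p a l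
¬closed-walk loopless short l<g W with walk⇒path loopless short l<g W
... | w , w₀≡a , _ , wₗ≡a , inj , _ = <⇒≢ (1≤length W) (inj z≤n ≤-refl (trans w₀≡a (sym wₗ≡a)))

-- Trees grown leaf by leaf

-- In sprout t u d the new leaf is zero, the older vertices are shifted by suc, and the new arc goes from u to the
-- leaf iff d is true. The tree has one vertex more than its index.
data GrownTree : ℕ → Set where
  single : GrownTree 0
  sprout : ∀ {j} → GrownTree j → Fin (suc j) → Bool → GrownTree (suc j)

digraph : ∀ {j} → GrownTree j → Digraph (suc j)
arc (digraph single) _ _ = false
arc (digraph (sprout t u d)) zero zero = false
arc (digraph (sprout t u d)) zero (suc w) = does (w ≟ u) ∧ not d
arc (digraph (sprout t u d)) (suc v) zero = does (v ≟ u) ∧ d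
arc (digraph (sprout t u d)) (suc v) (suc w) = arc (digraph t) v w

new-edge : ∀ {j} (t : GrownTree j) u d → Adj (digraph (sprout t u d)) zero (suc u)
new-edge t u d with u ≟ u
new-edge t u true | yes _ = inj₂ refl
new-edge t u false | yes _ = inj₁ refl
new-edge t u d | no u≢u = contradiction refl u≢u

-- branch t v w is the number of ancestors of v (itself included) that are not ancestors of w.
branch : ∀ {j} → GrownTree j → Fin (suc j) → Fin (suc j) → ℕ
branch single _ _ = 0
branch (sprout t u d) zero zero = 0
branch (sprout t u d) zero (suc w) = suc (branch t u w)
branch (sprout t u d) (suc v) zero = branch t v u
branch (sprout t u d) (suc v) (suc w) = branch t v w

branch-refl : ∀ {j} (t : GrownTree j) v → branch t v v ≡ 0
branch-refl single v = refl
branch-refl (sprout t u d) zero = refl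
branch-refl (sprout t u d) (suc v) = branch-refl t v

-- The tree path climbs `branch t v w` edges to the last common ancestor and descends
-- `branch t w v`; injectivity of `f` prevents backtracking in `H`. The vertices `q` and `r` allow
-- the walk to be prolonged at either end.
tree-walk : ∀ {j m} (H : Digraph m) (t : GrownTree j) (f : Fin (suc j) → Fin m) → Injective _≡_ _≡_ f →
  (∀ v w → Adj (digraph t) v w → Adj H (f v) (f w)) → ∀ v w → v ≢ w →
  ∃ λ q → ∃ λ r → Adj (digraph t) v q × Adj (digraph t) r w ×
    Walk H (f v) (f q) (f r) (f w) (branch t v w + branch t w v)
tree-walk H single f inj hom zero zero v≢w = contradiction refl v≢w
tree-walk H (sprout t u d) f inj hom zero zero v≢w = contradiction refl v≢w
tree-walk H (sprout t u d) f inj hom zero (suc w) v≢w with u ≟ w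
... | yes refl rewrite branch-refl t u =
  suc u , zero , new-edge t u d , new-edge t u d , edge (hom _ _ (new-edge t u d))
... | no u≢w with tree-walk H t (f ∘ suc) (suc-injective ∘ inj) (λ v w → hom (suc v) (suc w)) u w u≢w
... | q , r , uq , rw , W = suc u , suc r , new-edge t u d , rw ,
  cons (hom _ _ (new-edge t u d)) (λ e → contradiction (inj e) λ ()) W
tree-walk H (sprout t u d) f inj hom (suc v) zero v≢w with v ≟ u
... | yes refl rewrite branch-refl t u =
  zero , suc u , swap (new-edge t u d) , swap (new-edge t u d) , edge (hom _ _ (swap (new-edge t u d)))
... | no v≢u with tree-walk H t (f ∘ suc) (suc-injective ∘ inj) (λ v w → hom (suc v) (suc w)) v u v≢u
... | q , r , vq , ru , W = suc q , suc u , vq , swap (new-edge t u d) ,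
  subst (Walk H _ _ _ _) (sym (+-suc _ _))
    (snoc W (hom _ _ (swap (new-edge t u d))) (λ e → contradiction (inj e) λ ()))
tree-walk H (sprout t u d) f inj hom (suc v) (suc w) v≢w
  with tree-walk H t (f ∘ suc) (suc-injective ∘ inj) (λ v w → hom (suc v) (suc w)) v w (v≢w ∘ cong suc)
... | q , r , vq , rw , W = suc q , suc r , vq , rw , W

-- Every oriented tree can be grown

record InducedCopy {s} (T : Digraph s) : Set where
  constructor inducedCopy
  field
    {size} : ℕ
    tree : GrownTree size
    place : Fin (suc size) → Fin s
    place-injective : Injective _≡_ _≡_ place
    arcs : ∀ v w → arc (digraph tree) v w ≡ arc T (place v) (place w)

open InducedCopy

crossing : ∀ {A : Set} {P : A → Set} → (∀ a → Dec (P a)) → ∀ l (w : Fin (suc l) → A) → P (w zero) → ¬ P (w (fromℕ l)) →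
  ∃ λ i → P (w (inject₁ i)) × ¬ P (w (suc i))
crossing P? zero w in₀ out = contradiction in₀ out
crossing P? (suc l) w in₀ out with P? (w (suc zero))
... | no out₁ = zero , in₀ , out₁
... | yes in₁ with crossing P? l (w ∘ suc) in₁ out
... | i , inᵢ , outᵢ = suc i , inᵢ , outᵢ

reverse-arc : ∀ {s} {T : Digraph s} → IsOriented T → ∀ {u v} → Adj T u v → arc T v u ≡ not (arc T u v)
reverse-arc (_ , asym) (inj₁ u→v) = trans (¬-not (asym _ _ u→v)) (cong not (sym u→v))
reverse-arc (_ , asym) (inj₂ v→u) = trans v→u (cong not (sym (¬-not (asym _ _ v→u))))

leaf-arcs : ∀ {s} {T : Digraph s} → IsOriented T → (C : InducedCopy T) → ∀ y u → Adj T (place C u) y →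
  (∀ w → Adj T y (place C w) → w ≡ u) →
  ∃ λ d → ∀ v w → arc (digraph (sprout (tree C) u d)) v w ≡ arc T ((y Vector.∷ place C) v) ((y Vector.∷ place C) w)
leaf-arcs {T = T} oriented@(irr , _) C y u uy only = d , same
  where
  f = place C
  d = arc T (f u) y
  same : ∀ v w → arc (digraph (sprout (tree C) u d)) v w ≡ arc T ((y Vector.∷ f) v) ((y Vector.∷ f) w)
  same zero zero = sym (¬-not (irr y))
  same zero (suc w) with w ≟ u
  ... | yes refl = sym (reverse-arc oriented uy)
  ... | no w≢u = sym (¬-not (w≢u ∘ only w ∘ inj₁))
  same (suc v) zero with v ≟ u
  ... | yes refl = refl
  ... | no v≢u = sym (¬-not (v≢u ∘ only v ∘ inj₂))
  same (suc v) (suc w) = arcs C v w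

-- Two neighbours of `y` in the copy are joined by a path inside it, which `y` would close to a walk
-- without backtracking.
leaf-unique : ∀ {s} {T : Digraph s} → IsOrientedTree T → (C : InducedCopy T) → ∀ y → (∀ v → place C v ≢ y) →
  ∀ u w → Adj T (place C u) y → Adj T y (place C w) → w ≡ u
leaf-unique {T = T} (oriented , _ , acyclic) C y new u w uy yw with w ≟ u
... | yes w≡u = w≡u
... | no w≢u with tree-walk T (tree C) (place C) (place-injective C)
       (λ a b → subst₂ (λ x z → x ≡ true ⊎ z ≡ true) (arcs C a b) (arcs C b a)) w u w≢u
... | q , r , _ , _ , W = contradiction
  (snoc (cons yw (new q ∘ sym) W) uy (new r))
  -- Cycles of every length are excluded, so the bound is taken just above the length of the walk.
  (¬closed-walk (oriented⇒loopless oriented) (λ k _ → acyclic k) ≤-refl)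

-- A walk in `T` from the copy to `y` leaves the copy at some step; the vertex reached there, not
-- necessarily `y`, is the new leaf.
add-leaf : ∀ {s} {T : Digraph s} → IsOrientedTree T → (C : InducedCopy T) → ∀ y → (∀ v → place C v ≢ y) →
  Σ (InducedCopy T) λ C′ → size C′ ≡ suc (size C)
add-leaf {T = T} isTree@(oriented , connected , _) C y new
  with connected (place C zero) y
... | l , w , start , end , adj
  with crossing (λ x → any? (λ v → place C v ≟ x)) l w (zero , sym start) (λ (v , e) → new v (trans e end))
... | i , (u , u≡wᵢ) , out with leaf-arcs {T = T} oriented C (w (suc i)) u uy
        (λ v → leaf-unique isTree C (w (suc i)) (λ v′ e → out (v′ , e)) u v uy)
  where
  uy : Adj T (place C u) (w (suc i))
  uy = subst (λ x → Adj T x (w (suc i))) (sym u≡wᵢ) (adj i)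
... | d , same = inducedCopy (sprout (tree C) u d) (w (suc i) Vector.∷ place C) injective same , refl
  where
  injective : Injective _≡_ _≡_ (w (suc i) Vector.∷ place C)
  injective {zero} {zero} _ = refl
  injective {zero} {suc b} e = contradiction (b , sym e) out
  injective {suc a} {zero} e = contradiction (a , e) out
  injective {suc a} {suc b} e = cong suc (place-injective C e)

-- Each new leaf trades a unit of `fuel` for one of `size`, and injectivity of `place` keeps `size`
-- below `s`, so the fuel cannot run out.
span : ∀ {s} {T : Digraph s} → IsOrientedTree T → ∀ fuel (C : InducedCopy T) → s < size C + fuel →
  Σ (InducedCopy T) λ C′ → ∀ y → ∃ λ v → place C′ v ≡ y
span isTree zero C s<size = contradiction (injective⇒≤ (place-injective C))
  (<⇒≱ (m<n⇒m<1+n (subst (_ <_) (+-identityʳ _) s<size)))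
span {s} isTree (suc fuel) C s<size with all? (λ y → any? (λ v → place C v ≟ y))
... | yes covers = C , covers
... | no ¬covers with ¬∀⟶∃¬ _ _ (λ y → any? (λ v → place C v ≟ y)) ¬covers
... | y , out with add-leaf isTree C y (λ v e → out (v , e))
... | C′ , bigger = span isTree fuel C′ (subst (s <_) (trans (+-suc _ _) (cong (_+ fuel) (sym bigger))) s<size)

spanning-copy : ∀ {s} {T : Digraph s} → 1 ≤ s → IsOrientedTree T →
  Σ (InducedCopy T) λ C → ∀ y → ∃ λ v → place C v ≡ y
spanning-copy {suc s} {T} _ isTree@((irr , _) , _) = span isTree (2 + s) (inducedCopy single (λ _ → zero)
  (λ { {zero} {zero} _ → refl }) (λ _ _ → sym (¬-not (irr zero)))) ≤-refl

-- Counting choices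

sum-≤ : ∀ {n} {f : Fin n → ℕ} {b} → (∀ i → f i ≤ b) → sum f ≤ n * b
sum-≤ {zero} _ = z≤n
sum-≤ {suc n} f≤b = +-mono-≤ (f≤b zero) (sum-≤ (f≤b ∘ suc))

sum-<⇒∃< : ∀ {n} (f : Fin n → ℕ) {b} → sum f < n * b → ∃ λ i → f i < b
sum-<⇒∃< {suc n} f {b} Σf<nb with b ≤? f zero
... | no b≰f₀ = zero , ≰⇒> b≰f₀
... | yes b≤f₀ with sum-<⇒∃< (f ∘ suc) (+-cancelˡ-< b _ _ (≤-<-trans (+-monoˡ-≤ _ b≤f₀) Σf<nb))
... | i , fᵢ<b = suc i , fᵢ<b

sum-positive : ∀ {n} (f : Fin n → ℕ) → 0 < sum f → ∃ λ i → 0 < f i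
sum-positive {suc n} f 0<Σf with f zero in eq
... | suc _ = zero , subst (0 <_) (sym eq) z<s
... | zero with sum-positive (f ∘ suc) 0<Σf
... | i , 0<fᵢ = suc i , 0<fᵢ

term≤sum : ∀ {n} (f : Fin n → ℕ) i → f i ≤ sum f
term≤sum f zero = m≤m+n _ _
term≤sum f (suc i) = ≤-trans (term≤sum (f ∘ suc) i) (m≤n+m _ _)

sum-unique-≤1 : ∀ {n} (f : Fin n → ℕ) → (∀ i → f i ≤ 1) → (∀ i j → 0 < f i → 0 < f j → i ≡ j) → sum f ≤ 1
sum-unique-≤1 {zero} f _ _ = z≤n
sum-unique-≤1 {suc n} f f≤1 unique with f zero in eq
... | zero = sum-unique-≤1 (f ∘ suc) (f≤1 ∘ suc) (λ i j p q → suc-injective (unique _ _ p q))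
... | suc m with sum (f ∘ suc) in rest
... | zero = subst (_≤ 1) (trans eq (sym (+-identityʳ _))) (f≤1 zero)
... | suc _ with sum-positive (f ∘ suc) (subst (0 <_) (sym rest) z<s)
... | i , 0<fᵢ with unique zero (suc i) (subst (0 <_) (sym eq) z<s) 0<fᵢ
... | ()

total : ∀ {D} j → (Vec (Fin D) j → ℕ) → ℕ
total zero f = f []
total (suc j) f = sum λ d → total j (f ∘ (d ∷_))

total-sum : ∀ {D m} j (f : Fin m → Vec (Fin D) j → ℕ) → sum (λ i → total j (f i)) ≡ total j (λ c → sum λ i → f i c)
total-sum zero f = refl
total-sum (suc j) f = trans (∑-comm λ i d → total j (f i ∘ (d ∷_))) (sum-cong-≗ λ d → total-sum j (λ i → f i ∘ (d ∷_)))

total-zero : ∀ {D} j (f : Vec (Fin D) j → ℕ) → (∀ c → f c ≡ 0) → total j f ≡ 0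
total-zero zero f f≡0 = f≡0 []
total-zero {D} (suc j) f f≡0 = n≤0⇒n≡0 (subst (total (suc j) f ≤_) (*-zeroʳ D)
  (sum-≤ λ d → ≤-reflexive (total-zero j (f ∘ (d ∷_)) (f≡0 ∘ (d ∷_)))))

-- Averaging: the mean of `f` over the `D ^ j` vectors is below 1.
total-<⇒∃zero : ∀ {D} j (f : Vec (Fin D) j → ℕ) → total j f < D ^ j → ∃ λ c → f c ≡ 0
total-<⇒∃zero zero f f<1 = [] , n≤0⇒n≡0 (s≤s⁻¹ f<1)
total-<⇒∃zero (suc j) f small with sum-<⇒∃< _ small
... | d , small-d with total-<⇒∃zero j (f ∘ (d ∷_)) small-d
... | c , fc≡0 = d ∷ c , fc≡0

data AgreeOff {A : Set} : ∀ {j} → Subset j → Vec A j → Vec A j → Set where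
  [] : AgreeOff [] [] []
  free : ∀ {j S c c′ d d′} → AgreeOff {j = j} S c c′ → AgreeOff (inside ∷ S) (d ∷ c) (d′ ∷ c′)
  keep : ∀ {j S c c′ d} → AgreeOff {j = j} S c c′ → AgreeOff (outside ∷ S) (d ∷ c) (d ∷ c′)

agreeOff-⊥ : ∀ {A : Set} {j} {c c′ : Vec A j} → AgreeOff ⊥ c c′ → c ≡ c′
agreeOff-⊥ [] = refl
agreeOff-⊥ (keep p) = cong (_ ∷_) (agreeOff-⊥ p)

agreeOff-refl : ∀ {A : Set} {j} (S : Subset j) {c : Vec A j} → AgreeOff S c c
agreeOff-refl [] {[]} = []
agreeOff-refl (inside ∷ S) {_ ∷ _} = free (agreeOff-refl S)
agreeOff-refl (outside ∷ S) {_ ∷ _} = keep (agreeOff-refl S)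

-- On the support of `f`, the coordinates off `S` determine those in `S`, which leaves room for at
-- most `D ^ (j - ∣ S ∣)` vectors.
Determined : ∀ {D j} → Subset j → (Vec (Fin D) j → ℕ) → Set
Determined S f = ∀ c c′ → AgreeOff S c c′ → 0 < f c → 0 < f c′ → c ≡ c′

-- At a free coordinate the slices f (d ∷_) have disjoint supports, so that their sum again satisfies the hypotheses.
total-determined : ∀ {D} j (S : Subset j) (f : Vec (Fin D) j → ℕ) → (∀ c → f c ≤ 1) → Determined S f →
  total j f * D ^ ∣ S ∣ ≤ D ^ j
total-determined zero [] f f≤1 _ = subst (_≤ 1) (sym (*-identityʳ _)) (f≤1 [])
total-determined {D} (suc j) (outside ∷ S) f f≤1 det = begin
  sum (λ d → total j (f ∘ (d ∷_))) * D ^ ∣ S ∣   ≡⟨ *-distribʳ-sum (D ^ ∣ S ∣) (λ d → total j (f ∘ (d ∷_))) ⟩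
  sum (λ d → total j (f ∘ (d ∷_)) * D ^ ∣ S ∣)   ≤⟨ sum-≤ (λ d → total-determined j S (f ∘ (d ∷_)) (f≤1 ∘ (d ∷_))
                                                     (λ c c′ a p q → ∷-injectiveʳ (det _ _ (keep a) p q))) ⟩
  D * D ^ j                                      ∎
  where open ≤-Reasoning
total-determined {D} (suc j) (inside ∷ S) f f≤1 det = begin
  sum (λ d → total j (f ∘ (d ∷_))) * (D * D ^ ∣ S ∣)  ≡⟨ cong (_* (D * D ^ ∣ S ∣)) (total-sum j (λ d → f ∘ (d ∷_))) ⟩
  total j g * (D * D ^ ∣ S ∣)                         ≡⟨ x∙yz≈y∙xz (total j g) D (D ^ ∣ S ∣) ⟩
  D * (total j g * D ^ ∣ S ∣)                         ≤⟨ *-monoʳ-≤ D (total-determined j S g g≤1 g-det) ⟩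
  D * D ^ j                                           ∎
  where
  open ≤-Reasoning
  g : Vec (Fin D) j → ℕ
  g c = sum λ d → f (d ∷ c)
  g≤1 : ∀ c → g c ≤ 1
  g≤1 c = sum-unique-≤1 _ (f≤1 ∘ (_∷ c)) (λ d d′ p q → ∷-injectiveˡ (det _ _ (free (agreeOff-refl S)) p q))
  g-det : Determined S g
  g-det c c′ a p q with sum-positive (λ d → f (d ∷ c)) p | sum-positive (λ d → f (d ∷ c′)) q
  ... | d , p′ | d′ , q′ = ∷-injectiveʳ (det _ _ (free a) p′ q′)

-- Each `f i` has mean at most `1 / D ^ k`, so the sum of all `r` of them has mean below 1.
union-bound : ∀ {D j k r} (f : Fin r → Vec (Fin D) j → ℕ) → 0 < D → r < D ^ k →
  (∀ i → total j (f i) * D ^ k ≤ D ^ j) → ∃ λ c → ∀ i → f i c ≡ 0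
union-bound {D} {j} {k} {r} f 0<D r<Dᵏ small with total-<⇒∃zero j (λ c → sum λ i → f i c) few
  where
  instance
    D≢0 : NonZero D
    D≢0 = >-nonZero 0<D
  few : total j (λ c → sum λ i → f i c) < D ^ j
  few = *-cancelʳ-< (D ^ k) _ _ (begin-strict
    total j (λ c → sum λ i → f i c) * D ^ k  ≡⟨ cong (_* D ^ k) (total-sum j f) ⟨
    sum (λ i → total j (f i)) * D ^ k        ≡⟨ *-distribʳ-sum (D ^ k) (λ i → total j (f i)) ⟩
    sum (λ i → total j (f i) * D ^ k)        ≤⟨ sum-≤ small ⟩
    -- Strictness needs `D ^ j` positive, hence `0 < D`.
    r * D ^ j                                <⟨ *-monoˡ-< (D ^ j) {{m^n≢0 D j}} r<Dᵏ ⟩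
    D ^ k * D ^ j                            ≡⟨ *-comm (D ^ k) (D ^ j) ⟩
    D ^ j * D ^ k                            ∎)
    where open ≤-Reasoning
... | c , none = c , λ i → n≤0⇒n≡0 (subst (f i c ≤_) none (term≤sum (λ i → f i c) i))

-- The last k of the ancestors counted by branch t v w, as positions in a vector of choices.
limb : ∀ {j} → ℕ → GrownTree j → Fin (suc j) → Fin (suc j) → Subset j
limb zero _ _ _ = ⊥
limb (suc k) single _ _ = []
limb (suc k) (sprout t u d) zero zero = ⊥
limb (suc k) (sprout t u d) zero (suc w) = inside ∷ limb k t u w
limb (suc k) (sprout t u d) (suc v) zero = outside ∷ limb (suc k) t v u
limb (suc k) (sprout t u d) (suc v) (suc w) = outside ∷ limb (suc k) t v w

∣limb∣ : ∀ {j} k (t : GrownTree j) v w → k ≤ branch t v w → ∣ limb k t v w ∣ ≡ k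
∣limb∣ {j} zero t v w _ = ∣⊥∣≡0 j
∣limb∣ (suc k) (sprout t u d) zero (suc w) (s≤s k≤b) = cong suc (∣limb∣ k t u w k≤b)
∣limb∣ (suc k) (sprout t u d) (suc v) zero k≤b = ∣limb∣ (suc k) t v u k≤b
∣limb∣ (suc k) (sprout t u d) (suc v) (suc w) k≤b = ∣limb∣ (suc k) t v w k≤b

-- Peeling off kernels and antikernels

Toward : ∀ {n} → Digraph n → Bool → Fin n → Fin n → Set
Toward G true u v = Arc G u v
Toward G false u v = Arc G v u

Colouring : ∀ {n} → Digraph n → Subset n → ℕ → Set
Colouring {n} G X m = Σ (Fin n → ℕ) λ col → (∀ {u} → u ∈ X → col u < m) ×
  (∀ {u v} → u ∈ X → v ∈ X → Adj G u v → col u ≢ col v)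

-- The outcome of removing `D` successive kernels (antikernels if `d` is `false`), each taken in
-- what the earlier ones leave of `X`: `child i y` is a neighbour of `y` in the `i`-th one, and
-- `recolour` spends one new colour on each, as they are independent.
record Peeling {n} (G : Digraph n) (d : Bool) (D : ℕ) (X : Subset n) : Set where
  field
    rest : Subset n
    rest⊆X : rest ⊆ X
    child : Fin D → Σ (Fin n) (_∈ rest) → Fin n
    child∈X : ∀ i y → child i y ∈ X
    child∉rest : ∀ i y → child i y ∉ rest
    child-arc : ∀ i y → Toward G d (proj₁ y) (child i y)
    child-injective : ∀ i i′ y y′ → child i y ≡ child i′ y′ → i ≡ i′
    recolour : ∀ m → Colouring G rest m → Colouring G X (D + m)

directed-kernel : ∀ {n} {G : Digraph n} → BikernelPerfect G → ∀ d X →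
  ∃ λ K → K ⊆ X × Independent G K × (∀ u → u ∈ X → u ∉ K → ∃ λ v → v ∈ K × Toward G d u v)
directed-kernel perfect true X = proj₁ (perfect X)
directed-kernel perfect false X = proj₂ (perfect X)

peel : ∀ {n} {G : Digraph n} → BikernelPerfect G → ∀ d D X → Peeling G d D X
peel perfect d zero X = record
  { rest = X ; rest⊆X = λ x∈X → x∈X ; child = λ () ; child∈X = λ () ; child∉rest = λ () ; child-arc = λ ()
  ; child-injective = λ () ; recolour = λ m col → col }
peel {n} {G} perfect d (suc D) X with directed-kernel {G = G} perfect d X
... | K , K⊆X , indep , dominates = record
  { rest = rest
  ; rest⊆X = λ x∈rest → Y⊆X (rest⊆X x∈rest)
  ; child = child′
  ; child∈X = λ { zero y → K⊆X (target∈K y) ; (suc i) y → Y⊆X (child∈X i y) }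
  ; child∉rest = λ { zero y p → Y∌K (rest⊆X p) (target∈K y) ; (suc i) y → child∉rest i y }
  ; child-arc = λ { zero (y , p) → proj₂ (proj₂ (dominated y p)) ; (suc i) y → child-arc i y }
  ; child-injective = injective
  ; recolour = recolour′
  }
  where
  Y = X ∩ ∁ K
  open Peeling (peel {G = G} perfect d D Y)
  Y⊆X : Y ⊆ X
  Y⊆X p = proj₁ (x∈p∩q⁻ X (∁ K) p)
  Y∌K : ∀ {x} → x ∈ Y → x ∉ K
  Y∌K p = x∈∁p⇒x∉p (proj₂ (x∈p∩q⁻ X (∁ K) p))
  dominated : ∀ y → y ∈ rest → ∃ λ v → v ∈ K × Toward G d y v
  dominated y p = dominates y (Y⊆X (rest⊆X p)) (Y∌K (rest⊆X p))
  child′ : Fin (suc D) → Σ (Fin n) (_∈ rest) → Fin n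
  child′ zero (y , p) = proj₁ (dominated y p)
  child′ (suc i) y = child i y
  target∈K : ∀ y → child′ zero y ∈ K
  target∈K (y , p) = proj₁ (proj₂ (dominated y p))
  injective : ∀ i i′ y y′ → child′ i y ≡ child′ i′ y′ → i ≡ i′
  injective zero zero y y′ _ = refl
  injective zero (suc i′) y y′ e = contradiction (target∈K y) (subst (_∉ K) (sym e) (Y∌K (child∈X i′ y′)))
  injective (suc i) zero y y′ e = contradiction (target∈K y′) (subst (_∉ K) e (Y∌K (child∈X i y)))
  injective (suc i) (suc i′) y y′ e = cong suc (child-injective i i′ y y′ e)
  recolour′ : ∀ m → Colouring G rest m → Colouring G X (suc D + m)
  recolour′ m colouring with recolour m colouring
  ... | col , bounded , proper = col′ , bounded′ , proper′
    where
    col′ : Fin n → ℕ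
    col′ u with u ∈? K
    ... | yes _ = D + m
    ... | no _ = col u
    bounded′ : ∀ {u} → u ∈ X → col′ u < suc D + m
    bounded′ {u} u∈X with u ∈? K
    ... | yes _ = ≤-refl
    ... | no u∉K = m<n⇒m<1+n (bounded (x∈p∩q⁺ (u∈X , x∉p⇒x∈∁p u∉K)))
    proper′ : ∀ {u v} → u ∈ X → v ∈ X → Adj G u v → col′ u ≢ col′ v
    proper′ {u} {v} u∈X v∈X uv with u ∈? K | v ∈? K
    ... | yes u∈K | yes v∈K = contradiction uv (indep u v u∈K v∈K)
    ... | yes _ | no v∉K = <⇒≢ (bounded (x∈p∩q⁺ (v∈X , x∉p⇒x∈∁p v∉K))) ∘ sym
    ... | no u∉K | yes _ = <⇒≢ (bounded (x∈p∩q⁺ (u∈X , x∉p⇒x∈∁p u∉K)))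
    ... | no u∉K | no v∉K = proper (x∈p∩q⁺ (u∈X , x∉p⇒x∈∁p u∉K)) (x∈p∩q⁺ (v∈X , x∉p⇒x∈∁p v∉K)) uv

-- Homomorphisms given by choices

-- The leaf added last gets the block peeled off first: its older neighbour is then placed in
-- `rest`, where every vertex has a child in each kernel of the block.
data Layers {n} (G : Digraph n) (D : ℕ) : ∀ {j} → GrownTree j → Subset n → Set where
  root : ∀ {X r} → r ∈ X → Layers G D single X
  layer : ∀ {j X u d} {t : GrownTree j} (P : Peeling G d D X) → Layers G D t (Peeling.rest P) → Layers G D (sprout t u d) X

-- The hypothesis says that `X` needs more than `j * D` colours. A block accounts for at most `D` of
-- them, so after `j` blocks a vertex is left for the root.
layers : ∀ {n} {G : Digraph n} → BikernelPerfect G → ∀ D {j} (t : GrownTree j) X →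
  (∀ m → Colouring G X m → j * D < m) → Layers G D t X
layers perfect D single X uncolourable with nonempty? X
... | yes (r , r∈X) = root r∈X
... | no empty = contradiction
  (uncolourable 0 ((λ _ → 0) , (λ u∈X → contradiction (_ , u∈X) empty) , λ u∈X _ _ _ → empty (_ , u∈X))) λ ()
layers {G = G} perfect D (sprout t u d) X uncolourable = layer P (layers perfect D t (Peeling.rest P)
  λ m colouring → +-cancelˡ-< D _ m (uncolourable (D + m) (Peeling.recolour P m colouring)))
  where
  P : Peeling G d D X
  P = peel perfect d D X

module _ {n} {G : Digraph n} {D : ℕ} where

  locate : ∀ {j X} {t : GrownTree j} → Layers G D t X → Vec (Fin D) j → Fin (suc j) → Σ (Fin n) (_∈ X)
  locate (root r∈X) [] zero = _ , r∈X
  locate (layer {u = u} P L) (i ∷ c) zero = Peeling.child P i (locate L c u) , Peeling.child∈X P i _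
  locate (layer P L) (i ∷ c) (suc v) = map₂ (Peeling.rest⊆X P) (locate L c v)

  embed : ∀ {j X} {t : GrownTree j} → Layers G D t X → Vec (Fin D) j → Fin (suc j) → Fin n
  embed L c v = proj₁ (locate L c v)

  -- The block of a tree vertex does not depend on the choices, so `c` and `c′` may differ.
  embed-injective : ∀ {j X} {t : GrownTree j} (L : Layers G D t X) c c′ {v w} → embed L c v ≡ embed L c′ w → v ≡ w
  embed-injective (root _) [] [] {zero} {zero} _ = refl
  embed-injective (layer P L) (_ ∷ _) (_ ∷ _) {zero} {zero} _ = refl
  embed-injective (layer P L) (i ∷ c) (_ ∷ c′) {zero} {suc w} e =
    contradiction (subst (_∈ _) (sym e) (proj₂ (locate L c′ w))) (Peeling.child∉rest P i _)
  embed-injective (layer P L) (_ ∷ c) (i ∷ c′) {suc v} {zero} e =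
    contradiction (subst (_∈ _) e (proj₂ (locate L c v))) (Peeling.child∉rest P i _)
  embed-injective (layer P L) (_ ∷ c) (_ ∷ c′) {suc v} {suc w} e = cong suc (embed-injective L c c′ e)

  embed-arc : ∀ {j X} {t : GrownTree j} (L : Layers G D t X) c v w →
    Arc (digraph t) v w → Arc G (embed L c v) (embed L c w)
  embed-arc (layer {u = u} {d} P L) (i ∷ c) zero (suc w) a with w ≟ u | d | Peeling.child-arc P i (locate L c u)
  ... | yes refl | false | b = b
  embed-arc (layer {u = u} {d} P L) (i ∷ c) (suc v) zero a with v ≟ u | d | Peeling.child-arc P i (locate L c u)
  ... | yes refl | true | b = b
  embed-arc (layer P L) (i ∷ c) (suc v) (suc w) a = embed-arc L c v w a

  embed-adj : ∀ {j X} {t : GrownTree j} (L : Layers G D t X) c v w →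
    Adj (digraph t) v w → Adj G (embed L c v) (embed L c w)
  embed-adj L c v w (inj₁ a) = inj₁ (embed-arc L c v w a)
  embed-adj L c v w (inj₂ a) = inj₂ (embed-arc L c w v a)

  -- No coordinate of the limb belongs to an ancestor of `w`. Membership proofs must agree too,
  -- since `child` takes them as arguments; hence `locate` instead of `embed`.
  locate-off-limb : ∀ {j X} {t : GrownTree j} (L : Layers G D t X) k v w {c c′} →
    AgreeOff (limb k t v w) c c′ → locate L c w ≡ locate L c′ w
  locate-off-limb L zero v w a = cong (λ c → locate L c w) (agreeOff-⊥ a)
  locate-off-limb L@(root _) (suc k) v w [] = refl
  locate-off-limb L@(layer _ _) (suc k) zero zero a = cong (λ c → locate L c zero) (agreeOff-⊥ a)
  locate-off-limb (layer P L) (suc k) zero (suc w) (free a) =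
    cong (map₂ (Peeling.rest⊆X P)) (locate-off-limb L k _ w a)
  locate-off-limb (layer P L) (suc k) (suc v) zero (keep {d = i} a) =
    cong (λ y → Peeling.child P i y , Peeling.child∈X P i y) (locate-off-limb L (suc k) v _ a)
  locate-off-limb (layer P L) (suc k) (suc v) (suc w) (keep a) =
    cong (map₂ (Peeling.rest⊆X P)) (locate-off-limb L (suc k) v w a)

  leaf-adj : ∀ {j X u d} {t : GrownTree j} (P : Peeling G d D X) (L : Layers G D t (Peeling.rest P)) c →
    Adj G (embed (layer {u = u} P L) c zero) (embed (layer {u = u} P L) c (suc u))
  leaf-adj {u = u} {d} {t} P L c = embed-adj (layer P L) c zero (suc u) (new-edge t u d)

  leaf-apart : ∀ {j X u d} {t : GrownTree j} (P : Peeling G d D X) (L : Layers G D t (Peeling.rest P)) c c′ v →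
    embed (layer {u = u} P L) c zero ≢ embed (layer {u = u} P L) c′ (suc v)
  leaf-apart P L c c′ v e = contradiction (embed-injective (layer P L) c c′ e) λ ()

  -- At the oldest ancestor in the limb where the choices differ, the parent has one image and the
  -- ancestor two, which gives a walk of length 2. Each generation down to `v` adds an edge at both
  -- ends. Both end edges lie over the tree edge from `v` to `q`.
  divergence : ∀ {j X} {t : GrownTree j} (L : Layers G D t X) k v w {c c′} → AgreeOff (limb k t v w) c c′ →
    c ≡ c′ ⊎ ∃ λ q → ∃ λ l → Adj (digraph t) v q × l ≤ k + k ×
      Walk G (embed L c v) (embed L c q) (embed L c′ q) (embed L c′ v) l
  divergence L zero v w a = inj₁ (agreeOff-⊥ a)
  divergence L@(root _) (suc k) v w [] = inj₁ refl
  divergence L@(layer _ _) (suc k) zero zero a = inj₁ (agreeOff-⊥ a)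
  divergence (layer {u = u} {d} {t} P L) (suc k) zero (suc w) {c} {c′} (free {d = i} {d′ = i′} a)
    with divergence L k u w a
  ... | inj₂ (q , l , uq , l≤2k , W) = inj₂ (suc u , suc (suc l) , new-edge t u d ,
    subst (suc (suc l) ≤_) (cong suc (sym (+-suc k k))) (s≤s (s≤s l≤2k)) ,
    cons (leaf-adj P L c) (leaf-apart P L c c q) (snoc W (swap (leaf-adj P L c′)) (leaf-apart P L c′ c′ q ∘ sym)))
  ... | inj₁ refl with i ≟ i′
  ... | yes refl = inj₁ refl
  -- The two images of the leaf lie in different kernels, so the walk through the image of `u` does
  -- not backtrack.
  ... | no i≢i′ = inj₂ (suc u , 2 , new-edge t u d , s≤s (≤-trans (s≤s z≤n) (m≤n+m (suc k) k)) ,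
    cons (leaf-adj P L c) (i≢i′ ∘ Peeling.child-injective P i i′ _ _)
      (edge (swap (leaf-adj P L c′))))
  divergence (layer P L) (suc k) (suc v) zero (keep a) with divergence L (suc k) v _ a
  ... | inj₁ refl = inj₁ refl
  ... | inj₂ (q , rest) = inj₂ (suc q , rest)
  divergence (layer P L) (suc k) (suc v) (suc w) (keep a) with divergence L (suc k) v w a
  ... | inj₁ refl = inj₁ refl
  ... | inj₂ (q , rest) = inj₂ (suc q , rest)

-- Few choices produce clashes

adj? : ∀ {n} (H : Digraph n) u v → Dec (Adj H u v)
adj? H u v = (arc H u v ≟ᵇ true) ⊎-dec (arc H v u ≟ᵇ true)

indicator : ∀ {P : Set} → Dec P → ℕ
indicator (yes _) = 1
indicator (no _) = 0

indicator-≤1 : ∀ {P : Set} (p? : Dec P) → indicator p? ≤ 1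
indicator-≤1 (yes _) = ≤-refl
indicator-≤1 (no _) = z≤n

indicator-positive : ∀ {P : Set} (p? : Dec P) → 0 < indicator p? → P
indicator-positive (yes p) _ = p

indicator-zero : ∀ {P : Set} (p? : Dec P) → indicator p? ≡ 0 → ¬ P
indicator-zero (no ¬p) _ = ¬p

¬⇒indicator-zero : ∀ {P : Set} (p? : Dec P) → ¬ P → indicator p? ≡ 0
¬⇒indicator-zero (yes p) ¬p = contradiction p ¬p
¬⇒indicator-zero (no _) _ = refl

module _ {n} {G : Digraph n} {D : ℕ} {g : ℕ} (loopless : Loopless G) (short : NoShortCycle G g)
         {j} {t : GrownTree j} {X} (L : Layers G D t X) where

  Clash : Fin (suc j) → Fin (suc j) → Vec (Fin D) j → Set
  Clash v w c = (v ≢ w × ¬ Adj (digraph t) v w) × Adj G (embed L c v) (embed L c w)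

  clash? : ∀ v w c → Dec (Clash v w c)
  clash? v w c = (¬? (v ≟ w) ×-dec ¬? (adj? (digraph t) v w)) ×-dec adj? G (embed L c v) (embed L c w)

  clash-sym : ∀ {v w c} → Clash v w c → Clash w v c
  clash-sym ((v≢w , ¬vw) , a) = (v≢w ∘ sym , ¬vw ∘ swap) , swap a

  embed-≢ : ∀ c {v w} → v ≢ w → embed L c v ≢ embed L c w
  embed-≢ c v≢w e = v≢w (embed-injective L c c e)

  -- Distinct choices would give two images of `v`, joined by a walk of length at most `2k` and both
  -- adjacent to the common image of `w`: a closed walk of length at most `2k + 2`. It does not
  -- backtrack, since `q` is adjacent to `v` and `w` is not.
  clash-determined : ∀ {k} → 2 + (k + k) < g → ∀ v w {c c′} → AgreeOff (limb k t v w) c c′ →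
    Clash v w c → Clash v w c′ → c ≡ c′
  clash-determined {k} 2+2k<g v w {c} {c′} agree ((_ , ¬vw) , a) (_ , a′) with divergence L k v w agree
  ... | inj₁ c≡c′ = c≡c′
  ... | inj₂ (q , l , vq , l≤2k , W) = contradiction
    (subst (λ z → Walk G _ _ _ z _) (sym (cong proj₁ (locate-off-limb L k v w agree)))
      (snoc (cons (swap a) (embed-≢ c (q≢w ∘ sym)) W) a′ (embed-≢ c′ q≢w)))
    (¬closed-walk loopless short (≤-<-trans (s≤s (s≤s l≤2k)) 2+2k<g))
    where
    q≢w : q ≢ w
    q≢w q≡w = ¬vw (subst (Adj (digraph t) v) q≡w vq)

  -- Otherwise the image of the tree path, of length at most `2k - 2`, and the clashing edge form a
  -- closed walk shorter than `g`.
  branches-long : ∀ {k} → k + k < g → ∀ v w c → Clash v w c → k ≤ branch t v w ⊎ k ≤ branch t w v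
  branches-long {k} 2k<g v w c ((v≢w , ¬vw) , a) with k ≤? branch t v w | k ≤? branch t w v
  ... | yes long | _ = inj₁ long
  ... | no _ | yes long = inj₂ long
  ... | no short₁ | no short₂
    with tree-walk G t (embed L c) (embed-injective L c c) (embed-adj L c) v w v≢w
  ... | q , r , vq , rw , W = contradiction
    (cons (swap a) (embed-≢ c λ w≡q → ¬vw (subst (Adj (digraph t) v) (sym w≡q) vq)) W)
    (¬closed-walk loopless short (≤-<-trans (+-mono-≤ (≰⇒> short₁) (<⇒≤ (≰⇒> short₂))) 2k<g))

  clashes : Fin (suc j) → Fin (suc j) → Vec (Fin D) j → ℕ
  clashes v w c = indicator (clash? v w c)

  few-clashes-from-limb : ∀ {k} → 2 + (k + k) < g → ∀ v w (f : Vec (Fin D) j → ℕ) → (∀ c → f c ≤ 1) →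
    (∀ c → 0 < f c → Clash v w c) → k ≤ branch t v w → total j f * D ^ k ≤ D ^ j
  few-clashes-from-limb {k} 2+2k<g v w f f≤1 clash long =
    subst (λ m → total j f * D ^ m ≤ D ^ j) (∣limb∣ k t v w long)
      (total-determined j (limb k t v w) f f≤1
        (λ c c′ agree p q → clash-determined {k} 2+2k<g v w agree (clash c p) (clash c′ q)))

  -- The limb is taken on whichever side is long enough; if neither is, no choice clashes.
  few-clashes : ∀ {k} → 2 + (k + k) < g → ∀ v w → total j (clashes v w) * D ^ k ≤ D ^ j
  few-clashes {k} 2+2k<g v w = cases (k ≤? branch t v w) (k ≤? branch t w v)
    where
    cases : Dec (k ≤ branch t v w) → Dec (k ≤ branch t w v) → total j (clashes v w) * D ^ k ≤ D ^ j
    cases (yes long) _ = few-clashes-from-limb {k} 2+2k<g v w (clashes v w) (λ c → indicator-≤1 (clash? v w c))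
      (λ c → indicator-positive (clash? v w c)) long
    cases (no _) (yes long) = few-clashes-from-limb {k} 2+2k<g w v (clashes v w) (λ c → indicator-≤1 (clash? v w c))
      (λ c → clash-sym {c = c} ∘ indicator-positive (clash? v w c)) long
    cases (no short₁) (no short₂) = subst (λ m → m * D ^ k ≤ D ^ j) (sym (total-zero j (clashes v w) λ c →
      ¬⇒indicator-zero (clash? v w c) ([ short₁ , short₂ ]′ ∘ branches-long {k} (m+n≤o⇒n≤o 2 2+2k<g) v w c))) z≤n

  clash-free : ∀ {k} → 2 + (k + k) < g → 0 < D → suc j * suc j < D ^ k → ∃ λ c → ∀ v w → ¬ Clash v w c
  clash-free {k} 2+2k<g 0<D r<Dᵏ = proj₁ found , λ v w → indicator-zero (clash? v w (proj₁ found))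
    (subst (λ p → clashes (proj₁ p) (proj₂ p) (proj₁ found) ≡ 0) (remQuot-combine v w) (proj₂ found (combine v w)))
    where
    pair : Fin (suc j * suc j) → Fin (suc j) × Fin (suc j)
    pair = remQuot (suc j)
    found : ∃ λ c → ∀ i → clashes (proj₁ (pair i)) (proj₂ (pair i)) c ≡ 0
    -- All ordered pairs are run through by a single index, hence the square in the bound.
    found = union-bound {k = k} (λ i → clashes (proj₁ (pair i)) (proj₂ (pair i))) 0<D r<Dᵏ
      (λ i → few-clashes {k} 2+2k<g (proj₁ (pair i)) (proj₂ (pair i)))

  -- Tree arcs are preserved; other arcs between images are excluded by asymmetry, irreflexivity or
  -- the absence of clashes.
  embed-arcs : IsOriented G → ∀ c → (∀ v w → ¬ Clash v w c) → ∀ v w →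
    arc (digraph t) v w ≡ arc G (embed L c v) (embed L c w)
  embed-arcs (irr , asym) c unclashed v w with arc (digraph t) v w in vw | arc (digraph t) w v in wv | v ≟ w
  ... | true | _ | _ = sym (embed-arc L c v w vw)
  ... | false | true | _ = sym (¬-not (asym _ _ (embed-arc L c w v wv)))
  ... | false | false | yes refl = sym (¬-not (irr _))
  ... | false | false | no v≢w = sym (¬-not λ a → unclashed v w ((v≢w , ¬adj) , inj₁ a))
    where
    ¬adj : ¬ Adj (digraph t) v w
    ¬adj (inj₁ a) = contradiction (trans (sym a) vw) λ ()
    ¬adj (inj₂ a) = contradiction (trans (sym a) wv) λ ()

-- From the chromatic number to the number of choices

colouring⇒colorable : ∀ {n} {G : Digraph n} {m} → Colouring G ⊤ m → Colorable G m
colouring⇒colorable (col , bounded , proper) =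
  (λ u → fromℕ< (bounded (∈⊤ {x = u}))) , λ u v uv e → proper ∈⊤ ∈⊤ uv (fromℕ<-injective _ _ _ _ e)

^-distribʳ-* : ∀ n a b → (a * b) ^ n ≡ a ^ n * b ^ n
^-distribʳ-* zero a b = refl
^-distribʳ-* (suc n) a b = trans (cong (a * b *_) (^-distribʳ-* n a b)) (interchange a b (a ^ n) (b ^ n))

square-<-cancel : ∀ {a b} → a * a < b * b → a < b
square-<-cancel {a} {b} aa<bb with a <? b
... | yes a<b = a<b
... | no a≮b = contradiction (*-mono-≤ (≮⇒≥ a≮b) (≮⇒≥ a≮b)) (<⇒≱ aa<bb)

h≤⌈h/2⌉+⌈h/2⌉ : ∀ h → h ≤ ⌈ h /2⌉ + ⌈ h /2⌉
h≤⌈h/2⌉+⌈h/2⌉ h = subst (_≤ ⌈ h /2⌉ + ⌈ h /2⌉) (⌊n/2⌋+⌈n/2⌉≡n h) (+-monoˡ-≤ _ (⌊n/2⌋≤⌈n/2⌉ h))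

⌈h/2⌉+⌈h/2⌉≤1+h : ∀ h → ⌈ h /2⌉ + ⌈ h /2⌉ ≤ suc h
⌈h/2⌉+⌈h/2⌉≤1+h h = subst (⌈ h /2⌉ + ⌈ h /2⌉ ≤_) (⌊n/2⌋+⌈n/2⌉≡n (suc h)) (+-monoʳ-≤ ⌈ h /2⌉ (⌈n/2⌉-mono (n≤1+n h)))

-- With `h = g - 4`, `large` is the `h`-th power of `χ ≥ 2 s^(1 + 4/h)`, which avoids fractional
-- exponents.
module _ (s χ h : ℕ) {{_ : NonZero s}} {{_ : NonZero h}} (large : 2 ^ h * s ^ (4 + h) ≤ χ ^ h) where

  private
    D = χ / s

    s≤χ : s ≤ χ
    s≤χ with s ≤? χ
    ... | yes s≤χ = s≤χ
    ... | no s≰χ = contradiction large (<⇒≱ (begin-strict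
      χ ^ h                  <⟨ ^-monoˡ-< h (≰⇒> s≰χ) ⟩
      s ^ h                  ≤⟨ ^-monoʳ-≤ s (m≤n+m h 4) ⟩
      s ^ (4 + h)            ≤⟨ m≤n*m _ (2 ^ h) {{m^n≢0 2 h}} ⟩
      2 ^ h * s ^ (4 + h)    ∎))
      where open ≤-Reasoning

  quotient-positive : 0 < χ / s
  quotient-positive = m≥n⇒m/n>0 s≤χ

  private
    -- Since `D ≥ 1`, rounding down in `χ / s` loses less than a factor 2; the factor 2 in the
    -- hypothesis pays for it.
    χ<2Ds : χ < 2 * (D * s)
    χ<2Ds = begin-strict
      χ                  ≡⟨ m≡m%n+[m/n]*n χ s ⟩
      χ % s + D * s      <⟨ +-monoˡ-< (D * s) (m%n<n χ s) ⟩
      s + D * s          ≤⟨ +-monoˡ-≤ (D * s) (m≤n*m s D {{>-nonZero quotient-positive}}) ⟩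
      D * s + D * s      ≡⟨ cong (D * s +_) (+-identityʳ (D * s)) ⟨
      2 * (D * s)        ∎
      where open ≤-Reasoning

    s⁴<Dʰ : s ^ 4 < D ^ h
    s⁴<Dʰ = *-cancelʳ-< (s ^ h) _ _ (*-cancelˡ-< (2 ^ h) _ _ (begin-strict
      2 ^ h * (s ^ 4 * s ^ h)   ≡⟨ cong (2 ^ h *_) (^-distribˡ-+-* s 4 h) ⟨
      2 ^ h * s ^ (4 + h)       ≤⟨ large ⟩
      χ ^ h                     <⟨ ^-monoˡ-< h χ<2Ds ⟩
      (2 * (D * s)) ^ h         ≡⟨ ^-distribʳ-* h 2 (D * s) ⟩
      2 ^ h * (D * s) ^ h       ≡⟨ cong (2 ^ h *_) (^-distribʳ-* h D s) ⟩
      2 ^ h * (D ^ h * s ^ h)   ∎))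
      where open ≤-Reasoning

  -- The square root of `s ^ 4 < D ^ h ≤ D ^ (2k)` for `k = ⌈ h /2⌉`; `s * s` bounds the number of
  -- ordered pairs of tree vertices.
  pairs<choices : s * s < (χ / s) ^ ⌈ h /2⌉
  pairs<choices = square-<-cancel (begin-strict
    s * s * (s * s)                 ≡⟨ *-assoc s s (s * s) ⟩
    s * (s * (s * s))               ≡⟨ cong (λ z → s * (s * (s * z))) (*-identityʳ s) ⟨
    s ^ 4                           <⟨ s⁴<Dʰ ⟩
    D ^ h                           ≤⟨ ^-monoʳ-≤ D {{>-nonZero quotient-positive}} (h≤⌈h/2⌉+⌈h/2⌉ h) ⟩
    D ^ (⌈ h /2⌉ + ⌈ h /2⌉)         ≡⟨ ^-distribˡ-+-* D ⌈ h /2⌉ ⌈ h /2⌉ ⟩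
    D ^ ⌈ h /2⌉ * D ^ ⌈ h /2⌉       ∎)
    where open ≤-Reasoning

-- Induced oriented trees in bikernel-perfect graphs

module _ {s h n} {G : Digraph n} {{_ : NonZero s}} {{_ : NonZero h}}
         (oriented : IsOriented G) (perfect : BikernelPerfect G) (short : NoShortCycle G (4 + h))
         {χ} (χ-least : ∀ k → Colorable G k → χ ≤ k) (large : 2 ^ h * s ^ (4 + h) ≤ χ ^ h) where

  private
    D = χ / s

    0<D : 0 < D
    0<D = quotient-positive s χ h large

    loopless : Loopless G
    loopless = oriented⇒loopless oriented

  grown-layers : ∀ {j} (t : GrownTree j) → j < s → Layers G (χ / s) t ⊤
  grown-layers {j} t j<s = layers perfect D t ⊤ λ m colouring → begin-strict
    j * D  <⟨ *-monoˡ-< D {{>-nonZero 0<D}} j<s ⟩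
    s * D  ≡⟨ *-comm s D ⟩
    D * s  ≤⟨ m/n*n≤m χ s ⟩
    χ      ≤⟨ χ-least m (colouring⇒colorable colouring) ⟩
    m      ∎
    where open ≤-Reasoning

  contains-grown : ∀ {j} (t : GrownTree j) → j < s → ContainsInduced G (digraph t)
  contains-grown {j} t j<s = embed L (proj₁ choice) , embed-injective L _ _ ,
    embed-arcs loopless short L oriented (proj₁ choice) (proj₂ choice)
    where
    L : Layers G D t ⊤
    L = grown-layers t j<s
    choice : ∃ λ c → ∀ v w → ¬ Clash loopless short L v w c
    -- The largest value required is `2 + 2⌈ h /2⌉ ≤ 3 + h`, one below `4 + h`.
    choice = clash-free loopless short L {⌈ h /2⌉} (s≤s (s≤s (s≤s (⌈h/2⌉+⌈h/2⌉≤1+h h)))) 0<D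
      (≤-<-trans (*-mono-≤ j<s j<s) (pairs<choices s χ h large))

  -- As `place C` is a bijection, its inverse `preimage` followed by the copy of the grown tree in
  -- `G` embeds `T`.
  contains-tree : (T : Digraph s) → IsOrientedTree T → ContainsInduced G T
  contains-tree T isTree = f ∘ preimage ,
    (λ {x} {y} e → trans (sym (lies-over x)) (trans (cong (place C) (f-injective e)) (lies-over y))) ,
    λ x y → trans (cong₂ (arc T) (sym (lies-over x)) (sym (lies-over y)))
      (trans (sym (arcs C (preimage x) (preimage y))) (f-arcs (preimage x) (preimage y)))
    where
    spanning : Σ (InducedCopy T) λ C → ∀ y → ∃ λ v → place C v ≡ y
    spanning = spanning-copy (>-nonZero⁻¹ s) isTree
    C : InducedCopy T
    C = proj₁ spanning
    preimage : Fin s → Fin (suc (size C))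
    preimage y = proj₁ (proj₂ spanning y)
    lies-over : ∀ y → place C (preimage y) ≡ y
    lies-over y = proj₂ (proj₂ spanning y)
    copy : ContainsInduced G (digraph (tree C))
    copy = contains-grown (tree C) (injective⇒≤ (place-injective C))
    f : Fin (suc (size C)) → Fin n
    f = proj₁ copy
    f-injective : Injective _≡_ _≡_ f
    f-injective = proj₁ (proj₂ copy)
    f-arcs : ∀ v w → arc (digraph (tree C)) v w ≡ arc G (f v) (f w)
    f-arcs = proj₂ (proj₂ copy)

theorem10 : ∀ (s g n : ℕ) (G : Digraph n) → 1 ≤ s →
    IsOriented G → BikernelPerfect G → IsGirth G g → 5 ≤ g →
    ∀ (χ : ℕ) → IsChromaticNumber G χ →
    2 ^ (g ∸ 4) * s ^ g ≤ χ ^ (g ∸ 4) →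
    ∀ (T : Digraph s) → IsOrientedTree T → ContainsInduced G T
theorem10 s g n G 1≤s oriented perfect (_ , short) 5≤g χ (_ , χ-least) large =
  contains-tree {s} {g ∸ 4} {{>-nonZero 1≤s}} {{>-nonZero (m<n⇒0<n∸m 5≤g)}} oriented perfect
    (subst (NoShortCycle G) (sym 4+[g∸4]≡g) short) χ-least
    (subst (λ e → 2 ^ (g ∸ 4) * s ^ e ≤ χ ^ (g ∸ 4)) (sym 4+[g∸4]≡g) large)
  where
  4+[g∸4]≡g : 4 + (g ∸ 4) ≡ g
  4+[g∸4]≡g = m+[n∸m]≡n (<⇒≤ 5≤g)
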